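{- Let $(A,B)$ be an interpolation problem and let $a=b$ be a mixed literal, with $a$ $A$-local and $b$ $B$-local, and auxiliary variables $x$ (of the same type as $a$ and $b$) and $p_x$ (Boolean). Suppose that $I_1[EQ(x,s_1)]\ldots[EQ(x,s_n)]$ is a partial interpolant of the clause $C_1\lor a=b$, where $s_1,\ldots,s_n$ are terms, the sub-formulae $EQ(x,s_i) := (p_x \mathrel{\mathrm{xor}} (x=s_i))$ occur only positively, and $x$ and $p_x$ occur nowhere in this formula except as the displayed $x$ and $p_x$ in the $EQ(x,s_i)$. Suppose that $I_2(x)$ is a partial interpolant of the clause $C_2\lor a\neq b$ (where $x$ may occur at arbitrary positions). Then $I_1[I_2(s_1)]\ldots[I_2(s_n)]$, obtained by replacing each $EQ(x,s_i)$ by $I_2(s_i)$ (that is, $I_2$ with every $x$ substituted by $s_i$), is a partial interpolant of the clause $C_1\lor C_2$.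
   Context: Formulae are quantifier-free first-order formulae in the combined theory of equality with uninterpreted functions and linear arithmetic over $\mathbb{Q}$ and $\mathbb{Z}$ (with the integer division-by-constant functions $\lfloor\cdot/k\rfloor$, $k\ge 1$, in the signature); $\models$ is entailment in this theory. $\mathrm{symb}(F)$ is the set of non-theory symbols of $F$. An interpolation problem is a pair $(A,B)$ of formulae with $A\land B\models\bot$. A symbol is shared if it is in $\mathrm{symb}(A)\cap\mathrm{symb}(B)$, $A$-local if in $\mathrm{symb}(A)\setminus\mathrm{symb}(B)$, $B$-local if in $\mathrm{symb}(B)\setminus\mathrm{symb}(A)$. A term/literal is $A$-local ($B$-local) if it contains at least one $A$-local ($B$-local) symbol and no $B$-local ($A$-local) symbol, shared if it contains only shared symbols, mixed if it contains both $A$-local and $B$-local symbols. Projections. Each literal $\ell$ has projections $\ell\downharpoonright A$, $\ell\downharpoonright B$, extended to conjunctions of literals component-wise. For non-mixed literals: if $\ell$ is $A$-local, $\ell\downharpoonright A=\ell$ and $\ell\downharpoonright B=\top$; if $\ell$ is $B$-local, $\ell\downharpoonright A=\top$ and $\ell\downharpoonright B=\ell$; if $\ell$ is shared, then either (Pudlák) $\ell\downharpoonright A=\ell\downharpoonright B=\ell$, or (McMillan) $\ell\downharpoonright A=\top$, $\ell\downharpoonright B=\ell$, the choice being fixed throughout. For mixed literals, fresh auxiliary variables are used: $(a=b)\downharpoonright A := (a=x)$, $(a=b)\downharpoonright B := (x=b)$; $(a\neq b)\downharpoonright A := (p_x \mathrel{\mathrm{xor}} (a=x))$, $(a\neq b)\downharpoonright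 B := (\lnot p_x \mathrel{\mathrm{xor}} (x=b))$, with the same $x$ for $a=b$ and $a\ne b$; $(a+b\le c)\downharpoonright A := (a+x\le 0)$, $(a+b\le c)\downharpoonright B := (-x+b\le c)$, where $a$ is a linear combination of $A$-local variables, $b$ a linear combination of $B$-local and shared variables, $c$ a constant; a mixed inequality and its negation (rewritten as an inequality of the same form) have different auxiliary variables. Auxiliary variables belonging to different atoms are distinct, are fresh (do not occur in $A$, $B$ or the clauses), and count as shared symbols. Partial interpolant. A partial interpolant of a clause $C$ is a formula $I$ that is an interpolant of $A\land(\lnot C\downharpoonright A)$ and $B\land(\lnot C\downharpoonright B)$ ($\lnot C$ being a conjunction of literals), i.e. (i) $A\land\lnot C\downharpoonright A\models I$, (ii) $B\land\lnot C\downharpoonright B\land I\models\bot$, (iii) every non-theory symbol of $I$ is in $\mathrm{symb}(A)\cap\mathrm{symb}(B)$ or is an auxiliary variable introduced by the projections of the literals of $\lnot C$. $F[G_1]\ldots[G_n]$ denotes a formula in negation normal form with sub-formulae $G_1,\ldots,G_n$ occurring positively; $F[G_1']\ldots[G_n']$ is the result of replacing them by $G_1',\ldots,G_n'$. $F(t)$ denotes a formula with a sub-term $t$ that can appear anywhere, and $F(t')$ is the result of substituting $t'$ for it. Clauses are built over the literals of the proof, and $C_1,C_2$ contain neither the pivot literal nor its negation. -}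

module Defs where

open import Data.Bool using (Bool; true; false; not) renaming (T to IsTrue)
open import Data.Empty using (⊥)
open import Data.Fin using (Fin)
open import Data.Integer as ℤ using (ℤ)
open import Data.Integer.DivMod using (_/ℕ_)
open import Data.List using (List; []; _∷_; _++_; map; foldr; concatMap)
open import Data.List.Membership.Propositional using (_∈_; _∉_)
open import Data.List.Properties using (≡-dec; map-∘)
open import Data.List.Relation.Unary.All using (All; []; _∷_)
open import Data.List.Relation.Unary.Any using (Any)
open import Data.Nat as ℕ using (ℕ; NonZero)
open import Data.Product using (_×_; _,_; map₁)
import Data.Product.Properties as Product
open import Data.Rational as ℚ using (ℚ)
open import Data.Sum using (_⊎_)
open import Data.Unit using (⊤)
open import Relation.Binary.Definitions using (DecidableEquality)
open import Relation.Binary.PropositionalEquality using (_≡_; refl; subst)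
open import Relation.Nullary using (¬_; yes; no)

infix  4 _⊨_ _≟ⁿ_ _≟ᵛ_ _≟ᵇ_ _≟ᵒ_ _≟ᶠ⁺_ _≤ᵛ_ _<ᵛ_
infixr 6 _∧ᶠ_ _∧ᶜ_ _xorᶠ_
infixr 5 _∨ᶠ_ _∨ᶜ_
infix  7 _≐_ _⊴_
infix  8 ¬ᶠ_
infix  9 _⁺

data Num : Set where
  int rat : Num

Value : Num → Set
Value int = ℤ
Value rat = ℚ

data Sort (U : Set) : Set where
  num           : Num → Sort U
  uninterpreted : U → Sort U

-- Non-theory symbols.  Variables (of a term sort) are the elements of
-- Fun [] s; propositional variables are the elements of Rel [].
-- Decidable equality of function symbols is what makes substitution for a
-- variable definable.
record Signature : Set₁ where
  field
    USort : Set
    _≟ᵘ_  : DecidableEquality USort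
    Fun   : List (Sort USort) → Sort USort → Set
    _≟ᶠ_  : ∀ {ss s} → DecidableEquality (Fun ss s)
    Rel   : List (Sort USort) → Set

SortOf : Signature → Set
SortOf S = Sort (Signature.USort S)

Var : (S : Signature) → SortOf S → Set
Var S s = Signature.Fun S [] s

data Symbol (S : Signature) : Set where
  fun : ∀ {ss s} → Signature.Fun S ss s → Symbol S
  rel : ∀ {ss} → Signature.Rel S ss → Symbol S

-- Theory functions of linear arithmetic; floorDiv k is ⌊·/k⌋.
data Op {U : Set} : List (Sort U) → Sort U → Set where
  const    : ∀ {n} → Value n → Op [] (num n)
  add      : ∀ {n} → Op (num n ∷ num n ∷ []) (num n)
  scale    : ∀ {n} → Value n → Op (num n ∷ []) (num n)
  floorDiv : (k : ℕ) .{{_ : NonZero k}} → Op (num int ∷ []) (num int)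

data Term (S : Signature) : SortOf S → Set where
  app : ∀ {ss s} → Signature.Fun S ss s → All (Term S) ss → Term S s
  op  : ∀ {ss s} → Op ss s → All (Term S) ss → Term S s

Terms : (S : Signature) → List (SortOf S) → Set
Terms S = All (Term S)

data Atom (S : Signature) : Set where
  eq   : ∀ {s} → Term S s → Term S s → Atom S
  le   : ∀ {n} → Term S (num n) → Term S (num n) → Atom S
  lt   : ∀ {n} → Term S (num n) → Term S (num n) → Atom S
  pred : ∀ {ss} → Signature.Rel S ss → Terms S ss → Atom S

data Formula (S : Signature) : Set where
  atom       : Atom S → Formula S
  ⊤ᶠ ⊥ᶠ      : Formula S
  ¬ᶠ_        : Formula S → Formula S
  _∧ᶠ_ _∨ᶠ_  : Formula S → Formula S → Formula S

_xorᶠ_ : ∀ {S} → Formula S → Formula S → Formula S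
F xorᶠ G = (F ∧ᶠ ¬ᶠ G) ∨ᶠ (¬ᶠ F ∧ᶠ G)

⋀ : ∀ {S} → List (Formula S) → Formula S
⋀ = foldr _∧ᶠ_ ⊤ᶠ

var : ∀ {S s} → Var S s → Term S s
var x = app x []

_≐_ : ∀ {S s} → Term S s → Term S s → Formula S
t ≐ u = atom (eq t u)

plus : ∀ {S n} → Term S (num n) → Term S (num n) → Term S (num n)
plus t u = op add (t ∷ u ∷ [])

numeral : ∀ {S n} → Value n → Term S (num n)
numeral c = op (const c) []

times : ∀ {S n} → Value n → Term S (num n) → Term S (num n)
times c t = op (scale c) (t ∷ [])

zeroᵛ : (n : Num) → Value n
zeroᵛ int = ℤ.0ℤ
zeroᵛ rat = ℚ.0ℚ

negᵛ : ∀ {n} → Value n → Value n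
negᵛ {int} = ℤ.-_
negᵛ {rat} = ℚ.-_

minus : ∀ {S n} → Term S (num n) → Term S (num n)
minus {n = int} = times ℤ.-1ℤ
minus {n = rat} = times (ℚ.- ℚ.1ℚ)

symbolsᵗ  : ∀ {S s}  → Term S s   → List (Symbol S)
symbolsᵗˢ : ∀ {S ss} → Terms S ss → List (Symbol S)
symbolsᵗ (app f ts) = fun f ∷ symbolsᵗˢ ts
symbolsᵗ (op o ts)  = symbolsᵗˢ ts
symbolsᵗˢ []        = []
symbolsᵗˢ (t ∷ ts)  = symbolsᵗ t ++ symbolsᵗˢ ts

symbolsᵃ : ∀ {S} → Atom S → List (Symbol S)
symbolsᵃ (eq t u)    = symbolsᵗ t ++ symbolsᵗ u
symbolsᵃ (le t u)    = symbolsᵗ t ++ symbolsᵗ u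
symbolsᵃ (lt t u)    = symbolsᵗ t ++ symbolsᵗ u
symbolsᵃ (pred r ts) = rel r ∷ symbolsᵗˢ ts

symb : ∀ {S} → Formula S → List (Symbol S)
symb (atom a) = symbolsᵃ a
symb ⊤ᶠ       = []
symb ⊥ᶠ       = []
symb (¬ᶠ F)   = symb F
symb (F ∧ᶠ G) = symb F ++ symb G
symb (F ∨ᶠ G) = symb F ++ symb G

Carrier : {U : Set} → (U → Set) → Sort U → Set
Carrier D (num n)           = Value n
Carrier D (uninterpreted u) = D u

-- Equality of domain elements is decidable and relations are Bool-valued, so
-- every formula is either true or false in a structure, as it is classically.
record Structure (S : Signature) : Set₁ where
  open Signature S
  field
    Dom   : USort → Set
    point : ∀ u → Dom u
    _≟ᵈ_  : ∀ {u} → DecidableEquality (Dom u)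
    funᴹ  : ∀ {ss s} → Fun ss s → All (Carrier Dom) ss → Carrier Dom s
    relᴹ  : ∀ {ss} → Rel ss → All (Carrier Dom) ss → Bool

addᵛ mulᵛ : ∀ {n} → Value n → Value n → Value n
addᵛ {int} = ℤ._+_
addᵛ {rat} = ℚ._+_
mulᵛ {int} = ℤ._*_
mulᵛ {rat} = ℚ._*_

_≤ᵛ_ _<ᵛ_ : ∀ {n} → Value n → Value n → Set
_≤ᵛ_ {int} = ℤ._≤_
_≤ᵛ_ {rat} = ℚ._≤_
_<ᵛ_ {int} = ℤ._<_
_<ᵛ_ {rat} = ℚ._<_

-- _/ℕ_ leaves a non-negative remainder, so it is the floor.
evalOp : ∀ {U ss s} (D : U → Set) → Op ss s → All (Carrier D) ss → Carrier D s
evalOp D (const c)    []           = c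
evalOp D add          (v ∷ w ∷ []) = addᵛ v w
evalOp D (scale c)    (v ∷ [])     = mulᵛ c v
evalOp D (floorDiv k) (v ∷ [])     = v /ℕ k

module _ {S : Signature} (M : Structure S) where
  open Structure M

  infix 4 _⊩_

  eval  : ∀ {s}  → Term S s   → Carrier Dom s
  evals : ∀ {ss} → Terms S ss → All (Carrier Dom) ss
  eval (app f ts) = funᴹ f (evals ts)
  eval (op o ts)  = evalOp Dom o (evals ts)
  evals []        = []
  evals (t ∷ ts)  = eval t ∷ evals ts

  Holds : Atom S → Set
  Holds (eq t u)       = eval t ≡ eval u
  Holds (le {n} t u)   = _≤ᵛ_ {n} (eval t) (eval u)
  Holds (lt {n} t u)   = _<ᵛ_ {n} (eval t) (eval u)
  Holds (pred r ts)    = IsTrue (relᴹ r (evals ts))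

  _⊩_ : Formula S → Set
  _⊩_ (atom a) = Holds a
  _⊩_ ⊤ᶠ       = ⊤
  _⊩_ ⊥ᶠ       = ⊥
  _⊩_ (¬ᶠ F)   = ¬ (_⊩_ F)
  _⊩_ (F ∧ᶠ G) = _⊩_ F × _⊩_ G
  _⊩_ (F ∨ᶠ G) = _⊩_ F ⊎ _⊩_ G

_⊨_ : ∀ {S} → Formula S → Formula S → Set₁
_⊨_ {S} F G = (M : Structure S) → M ⊩ F → M ⊩ G

InterpolationProblem : ∀ {S} → Formula S → Formula S → Set₁
InterpolationProblem A B = A ∧ᶠ B ⊨ ⊥ᶠ

LinComb : (S : Signature) → Num → Set
LinComb S n = List (Value n × Var S (num n))

linTerm : ∀ {S n} → LinComb S n → Term S (num n)
linTerm {n = n} =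
  foldr (λ (c , v) t → plus (times c (var v)) t) (numeral (zeroᵛ n))

linSymbols : ∀ {S n} → LinComb S n → List (Symbol S)
linSymbols = map (λ (_ , v) → fun v)

linNeg : ∀ {S n} → LinComb S n → LinComb S n
linNeg {n = n} = map (map₁ (negᵛ {n}))

-- The right-hand side of an inequality t ≤ c.  Over ℚ a strict bound is
-- needed as well, so that negations stay of the same form
-- (t < c is t ≤ c - ε for an infinitesimal ε).
data Bound : Num → Set where
  atMost : ∀ {n} → Value n → Bound n
  below  : ℚ → Bound rat

_⊴_ : ∀ {S n} → Term S (num n) → Bound n → Formula S
t ⊴ atMost c = atom (le t (numeral c))
t ⊴ below c  = atom (lt t (numeral c))

-- ¬ (t ⊴ c) is equivalent to (- t) ⊴ boundNeg c.
boundNeg : ∀ {n} → Bound n → Bound n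
boundNeg {int} (atMost c) = atMost (ℤ.- c ℤ.- ℤ.1ℤ)
boundNeg {rat} (atMost c) = below (ℚ.- c)
boundNeg {rat} (below c)  = atMost (ℚ.- c)

_≟ⁿ_ : DecidableEquality Num
int ≟ⁿ int = yes refl
int ≟ⁿ rat = no λ ()
rat ≟ⁿ int = no λ ()
rat ≟ⁿ rat = yes refl

_≟ᵛ_ : ∀ {n} → DecidableEquality (Value n)
_≟ᵛ_ {int} = ℤ._≟_
_≟ᵛ_ {rat} = ℚ._≟_

_≟ᵇ_ : ∀ {n} → DecidableEquality (Bound n)
_≟ᵇ_ {n} (atMost c) (atMost d) with _≟ᵛ_ {n} c d
... | yes refl = yes refl
... | no c≢d   = no λ { refl → c≢d refl }
atMost _ ≟ᵇ below _  = no λ ()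
below _  ≟ᵇ atMost _ = no λ ()
below c  ≟ᵇ below d with c ℚ.≟ d
... | yes refl = yes refl
... | no c≢d   = no λ { refl → c≢d refl }

_≟ᵒ_ : ∀ {U ss} {s : Sort U} → DecidableEquality (Op ss s)
_≟ᵒ_ (const {n} c) (const d) with _≟ᵛ_ {n} c d
... | yes refl = yes refl
... | no c≢d   = no λ { refl → c≢d refl }
add ≟ᵒ add = yes refl
_≟ᵒ_ (scale {n} c) (scale d) with _≟ᵛ_ {n} c d
... | yes refl = yes refl
... | no c≢d   = no λ { refl → c≢d refl }
scale _    ≟ᵒ floorDiv _ = no λ ()
floorDiv _ ≟ᵒ scale _    = no λ ()
floorDiv k ≟ᵒ floorDiv l with k ℕ.≟ l
... | yes refl = yes refl
... | no k≢l   = no λ { refl → k≢l refl }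

module _ {S : Signature} where
  open Signature S

  infix 4 _≟ˢ_ _≟ˢˢ_ _≟ᵗ_ _≟ᵗˢ_ _≟ˡ_

  _≟ˢ_ : DecidableEquality (SortOf S)
  num m ≟ˢ num n with m ≟ⁿ n
  ... | yes refl = yes refl
  ... | no m≢n   = no λ { refl → m≢n refl }
  num _ ≟ˢ uninterpreted _ = no λ ()
  uninterpreted _ ≟ˢ num _ = no λ ()
  uninterpreted u ≟ˢ uninterpreted v with u ≟ᵘ v
  ... | yes refl = yes refl
  ... | no u≢v   = no λ { refl → u≢v refl }

  _≟ˢˢ_ : DecidableEquality (List (SortOf S))
  _≟ˢˢ_ = ≡-dec _≟ˢ_

  _≟ᵗ_  : ∀ {s}  → DecidableEquality (Term S s)
  _≟ᵗˢ_ : ∀ {ss} → DecidableEquality (Terms S ss)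
  app {ss} f ts ≟ᵗ app {ss′} g us with ss ≟ˢˢ ss′
  ... | no ss≢ = no λ { refl → ss≢ refl }
  ... | yes refl with f ≟ᶠ g | ts ≟ᵗˢ us
  ...   | yes refl | yes refl = yes refl
  ...   | no f≢g   | _        = no λ { refl → f≢g refl }
  ...   | yes _    | no ts≢us = no λ { refl → ts≢us refl }
  app _ _ ≟ᵗ op _ _  = no λ ()
  op _ _  ≟ᵗ app _ _ = no λ ()
  op {ss} o ts ≟ᵗ op {ss′} p us with ss ≟ˢˢ ss′
  ... | no ss≢ = no λ { refl → ss≢ refl }
  ... | yes refl with o ≟ᵒ p | ts ≟ᵗˢ us
  ...   | yes refl | yes refl = yes refl
  ...   | no o≢p   | _        = no λ { refl → o≢p refl }
  ...   | yes _    | no ts≢us = no λ { refl → ts≢us refl }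
  []       ≟ᵗˢ []       = yes refl
  (t ∷ ts) ≟ᵗˢ (u ∷ us) with t ≟ᵗ u | ts ≟ᵗˢ us
  ... | yes refl | yes refl = yes refl
  ... | no t≢u   | _        = no λ { refl → t≢u refl }
  ... | yes _    | no ts≢us = no λ { refl → ts≢us refl }

  _≟ˡ_ : ∀ {n} → DecidableEquality (LinComb S n)
  _≟ˡ_ {n} = ≡-dec (Product.≡-dec (_≟ᵛ_ {n}) _≟ᶠ_)

-- The auxiliary variables are new symbols, indexed by the atoms over S they
-- belong to.  Hence they occur in no formula, clause or term over S, and are
-- distinct for distinct atoms.  eqVar a b and boolVar a b are the variables x
-- and p_x of a = b; leVar a b c is the variable of a + b ≤ c.
data Fun⁺ (S : Signature) : List (SortOf S) → SortOf S → Set where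
  base  : ∀ {ss s} → Signature.Fun S ss s → Fun⁺ S ss s
  eqVar : ∀ {s} (a b : Term S s) → Fun⁺ S [] s
  leVar : ∀ {n} (a b : LinComb S n) (c : Bound n) → Fun⁺ S [] (num n)

data Rel⁺ (S : Signature) : List (SortOf S) → Set where
  base    : ∀ {ss} → Signature.Rel S ss → Rel⁺ S ss
  boolVar : ∀ {s} (a b : Term S s) → Rel⁺ S []

_≟ᶠ⁺_ : ∀ {S ss s} → DecidableEquality (Fun⁺ S ss s)
_≟ᶠ⁺_ {S} (base f) (base g) with Signature._≟ᶠ_ S f g
... | yes refl = yes refl
... | no f≢g   = no λ { refl → f≢g refl }
base _      ≟ᶠ⁺ eqVar _ _   = no λ ()
base _      ≟ᶠ⁺ leVar _ _ _ = no λ ()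
eqVar _ _   ≟ᶠ⁺ base _      = no λ ()
eqVar _ _   ≟ᶠ⁺ leVar _ _ _ = no λ ()
leVar _ _ _ ≟ᶠ⁺ base _      = no λ ()
leVar _ _ _ ≟ᶠ⁺ eqVar _ _   = no λ ()
eqVar a b ≟ᶠ⁺ eqVar a′ b′ with a ≟ᵗ a′ | b ≟ᵗ b′
... | yes refl | yes refl = yes refl
... | no a≢    | _        = no λ { refl → a≢ refl }
... | yes _    | no b≢    = no λ { refl → b≢ refl }
_≟ᶠ⁺_ {S} (leVar a b c) (leVar a′ b′ c′)
  with _≟ˡ_ {S} a a′ | _≟ˡ_ {S} b b′ | c ≟ᵇ c′
... | yes refl | yes refl | yes refl = yes refl
... | no a≢    | _        | _        = no λ { refl → a≢ refl }
... | yes _    | no b≢    | _        = no λ { refl → b≢ refl }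
... | yes _    | yes _    | no c≢    = no λ { refl → c≢ refl }

_⁺ : Signature → Signature
S ⁺ = record
  { USort = Signature.USort S
  ; _≟ᵘ_  = Signature._≟ᵘ_ S
  ; Fun   = Fun⁺ S
  ; _≟ᶠ_  = _≟ᶠ⁺_
  ; Rel   = Rel⁺ S
  }

liftᵗ  : ∀ {S s}  → Term S s   → Term (S ⁺) s
liftᵗˢ : ∀ {S ss} → Terms S ss → Terms (S ⁺) ss
liftᵗ (app f ts) = app (base f) (liftᵗˢ ts)
liftᵗ (op o ts)  = op o (liftᵗˢ ts)
liftᵗˢ []        = []
liftᵗˢ (t ∷ ts)  = liftᵗ t ∷ liftᵗˢ ts

liftᵃ : ∀ {S} → Atom S → Atom (S ⁺)
liftᵃ (eq t u)    = eq (liftᵗ t) (liftᵗ u)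
liftᵃ (le t u)    = le (liftᵗ t) (liftᵗ u)
liftᵃ (lt t u)    = lt (liftᵗ t) (liftᵗ u)
liftᵃ (pred r ts) = pred (base r) (liftᵗˢ ts)

lift : ∀ {S} → Formula S → Formula (S ⁺)
lift (atom a) = atom (liftᵃ a)
lift ⊤ᶠ       = ⊤ᶠ
lift ⊥ᶠ       = ⊥ᶠ
lift (¬ᶠ F)   = ¬ᶠ lift F
lift (F ∧ᶠ G) = lift F ∧ᶠ lift G
lift (F ∨ᶠ G) = lift F ∨ᶠ lift G

module _ {S : Signature} (A B : Formula S) where

  ALocalSymbol BLocalSymbol SharedSymbol : Symbol S → Set
  ALocalSymbol f = f ∈ symb A × f ∉ symb B
  BLocalSymbol f = f ∈ symb B × f ∉ symb A
  SharedSymbol f = f ∈ symb A × f ∈ symb B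

  -- Applied to the list of symbols of a term or literal.
  ALocal BLocal Shared Mixed : List (Symbol S) → Set
  ALocal fs = Any ALocalSymbol fs × All (λ f → ¬ BLocalSymbol f) fs
  BLocal fs = Any BLocalSymbol fs × All (λ f → ¬ ALocalSymbol f) fs
  Shared fs = All SharedSymbol fs
  Mixed  fs = Any ALocalSymbol fs × Any BLocalSymbol fs

  -- Non-mixed literals are arbitrary atoms with a sign (true is positive);
  -- mixed ones are a = b and a ≠ b with a A-local and b B-local, and
  -- a + b ≤ c.  The locality proofs are irrelevant, so propositional equality
  -- of literals is syntactic equality.
  data Literal : Set where
    aLocal  : Bool → (α : Atom S) → .(ALocal (symbolsᵃ α)) → Literal
    bLocal  : Bool → (α : Atom S) → .(BLocal (symbolsᵃ α)) → Literal
    shared  : Bool → (α : Atom S) → .(Shared (symbolsᵃ α)) → Literal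
    mixedEq : Bool → ∀ {s} (a b : Term S s) →
              .(ALocal (symbolsᵗ a)) → .(BLocal (symbolsᵗ b)) → Literal
    mixedLe : ∀ {n} (a b : LinComb S n) (c : Bound n) →
              .(Mixed (linSymbols a ++ linSymbols b)) →
              .(All ALocalSymbol (linSymbols a)) →
              .(All (λ f → BLocalSymbol f ⊎ SharedSymbol f) (linSymbols b)) →
              Literal

  Clause : Set
  Clause = List Literal

module _ {S : Signature} {A B : Formula S} where

  linSymbols-linNeg : ∀ {n} (a : LinComb S n) →
                      linSymbols {S} a ≡ linSymbols {S} (linNeg {S} a)
  linSymbols-linNeg = map-∘

  negate : Literal A B → Literal A B
  negate (aLocal σ α l)      = aLocal (not σ) α l
  negate (bLocal σ α l)      = bLocal (not σ) α l
  negate (shared σ α l)      = shared (not σ) α l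
  negate (mixedEq σ a b l m) = mixedEq (not σ) a b l m
  negate (mixedLe a b c m la lb)
    = mixedLe (linNeg {S} a) (linNeg {S} b) (boundNeg c)
        (subst (λ fs → Mixed A B (fs ++ linSymbols {S} (linNeg {S} b))) (linSymbols-linNeg a)
          (subst (λ fs → Mixed A B (linSymbols {S} a ++ fs)) (linSymbols-linNeg b) m))
        (subst (All _) (linSymbols-linNeg a) la)
        (subst (All _) (linSymbols-linNeg b) lb)

-- p_x xor (x = t), where x and p_x belong to the atom a = b
EQ : ∀ {S s} (a b : Term S s) → Term (S ⁺) s → Formula (S ⁺)
EQ a b t = atom (pred (boolVar a b) []) xorᶠ (var (eqVar a b) ≐ t)

data SharedProjection : Set where
  pudlák mcMillan : SharedProjection

signed : ∀ {S} → Bool → Atom S → Formula (S ⁺)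
signed true  α = atom (liftᵃ α)
signed false α = ¬ᶠ atom (liftᵃ α)

sharedProjA : ∀ {S} → SharedProjection → Bool → Atom S → Formula (S ⁺)
sharedProjA pudlák   σ α = signed σ α
sharedProjA mcMillan σ α = ⊤ᶠ

module _ {S : Signature} {A B : Formula S} (π : SharedProjection) where

  projA projB : Literal A B → Formula (S ⁺)

  projA (aLocal σ α _) = signed σ α
  projA (bLocal _ _ _) = ⊤ᶠ
  projA (shared σ α _) = sharedProjA π σ α
  projA (mixedEq true  a b _ _) = liftᵗ a ≐ var (eqVar a b)
  projA (mixedEq false a b _ _) =
    atom (pred (boolVar a b) []) xorᶠ (liftᵗ a ≐ var (eqVar a b))
  projA (mixedLe {n} a b c _ _ _) =
    plus (liftᵗ (linTerm a)) (var (leVar a b c)) ⊴ atMost (zeroᵛ n)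

  projB (aLocal _ _ _) = ⊤ᶠ
  projB (bLocal σ α _) = signed σ α
  projB (shared σ α _) = signed σ α
  projB (mixedEq true  a b _ _) = var (eqVar a b) ≐ liftᵗ b
  projB (mixedEq false a b _ _) =
    ¬ᶠ atom (pred (boolVar a b) []) xorᶠ (var (eqVar a b) ≐ liftᵗ b)
  projB (mixedLe a b c _ _ _) =
    plus (minus (var (leVar a b c))) (liftᵗ (linTerm b)) ⊴ c

  negProjA negProjB : Clause A B → Formula (S ⁺)
  negProjA C = ⋀ (map (λ ℓ → projA (negate ℓ)) C)
  negProjB C = ⋀ (map (λ ℓ → projB (negate ℓ)) C)

auxiliary : ∀ {S} {A B : Formula S} → Literal A B → List (Symbol (S ⁺))
auxiliary (aLocal _ _ _)          = []
auxiliary (bLocal _ _ _)          = []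
auxiliary (shared _ _ _)          = []
auxiliary (mixedEq true  a b _ _) = fun (eqVar a b) ∷ []
auxiliary (mixedEq false a b _ _) = rel (boolVar a b) ∷ fun (eqVar a b) ∷ []
auxiliary (mixedLe a b c _ _ _)   = fun (leVar a b c) ∷ []

record PartialInterpolant {S : Signature} (π : SharedProjection)
         (A B : Formula S) (C : Clause A B) (I : Formula (S ⁺)) : Set₁ where
  field
    fromA   : lift A ∧ᶠ negProjA π C ⊨ I
    refutes : lift B ∧ᶠ negProjB π C ∧ᶠ I ⊨ ⊥ᶠ
    symbols : ∀ {f} → f ∈ symb I →
              (f ∈ symb (lift A) × f ∈ symb (lift B))
              ⊎ f ∈ concatMap (λ ℓ → auxiliary (negate ℓ)) C

-- A formula in negation normal form with n sub-formulae left open; there is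
-- no negation above a hole, so they occur only positively.
data Context (S : Signature) (n : ℕ) : Set where
  lit       : Bool → Atom S → Context S n
  ⊤ᶜ ⊥ᶜ     : Context S n
  _∧ᶜ_ _∨ᶜ_ : Context S n → Context S n → Context S n
  hole      : Fin n → Context S n

fill : ∀ {S n} → Context S n → (Fin n → Formula S) → Formula S
fill (lit true  α) G = atom α
fill (lit false α) G = ¬ᶠ atom α
fill ⊤ᶜ            G = ⊤ᶠ
fill ⊥ᶜ            G = ⊥ᶠ
fill (F₁ ∧ᶜ F₂)    G = fill F₁ G ∧ᶠ fill F₂ G
fill (F₁ ∨ᶜ F₂)    G = fill F₁ G ∨ᶠ fill F₂ G
fill (hole i)      G = G i

symbolsᶜ : ∀ {S n} → Context S n → List (Symbol S)
symbolsᶜ (lit _ α)   = symbolsᵃ α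
symbolsᶜ ⊤ᶜ          = []
symbolsᶜ ⊥ᶜ          = []
symbolsᶜ (F₁ ∧ᶜ F₂)  = symbolsᶜ F₁ ++ symbolsᶜ F₂
symbolsᶜ (F₁ ∨ᶜ F₂)  = symbolsᶜ F₁ ++ symbolsᶜ F₂
symbolsᶜ (hole _)    = []

module _ {S : Signature} {r : SortOf S} (x : Var S r) (u : Term S r) where
  open Signature S

  substApp : ∀ {ss s} → Fun ss s → Terms S ss → Term S s
  substApp {ss} {s} f ts with _≟ˢˢ_ {S} ss [] | _≟ˢ_ {S} s r
  ... | no _     | _        = app f ts
  ... | yes _    | no _     = app f ts
  ... | yes refl | yes refl with f ≟ᶠ x
  ...   | yes _ = u
  ...   | no _  = app f ts

  substᵗ  : ∀ {s}  → Term S s   → Term S s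
  substᵗˢ : ∀ {ss} → Terms S ss → Terms S ss
  substᵗ (app f ts) = substApp f (substᵗˢ ts)
  substᵗ (op o ts)  = op o (substᵗˢ ts)
  substᵗˢ []        = []
  substᵗˢ (t ∷ ts)  = substᵗ t ∷ substᵗˢ ts

  substᵃ : Atom S → Atom S
  substᵃ (eq t v)    = eq (substᵗ t) (substᵗ v)
  substᵃ (le t v)    = le (substᵗ t) (substᵗ v)
  substᵃ (lt t v)    = lt (substᵗ t) (substᵗ v)
  substᵃ (pred p ts) = pred p (substᵗˢ ts)

  substᶠ : Formula S → Formula S
  substᶠ (atom α) = atom (substᵃ α)
  substᶠ ⊤ᶠ       = ⊤ᶠ
  substᶠ ⊥ᶠ       = ⊥ᶠ
  substᶠ (¬ᶠ F)   = ¬ᶠ substᶠ F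
  substᶠ (F ∧ᶠ G) = substᶠ F ∧ᶠ substᶠ G
  substᶠ (F ∨ᶠ G) = substᶠ F ∨ᶠ substᶠ G

_[_≔_] : ∀ {S s} → Formula S → Var S s → Term S s → Formula S
F [ x ≔ u ] = substᶠ x u F

{-# OPTIONS --safe #-}
module Submission where

-- The mixed literal a = b is split between the two sides by x and p_x, which
-- occur in the projections of no other literal (fresh-negProjA,
-- fresh-negProjB).  So x and p_x can be given any values in a model without
-- affecting A, B, the projections of the literals of C₁ and C₂, the terms t i
-- and the part of I₁ outside its holes (coincidenceᶠ).  Moreover I₂(t i) holds
-- in a model exactly if I₂ holds there once x is reset to the value of t i
-- (substitutionᶠ).
--
-- A implies the new interpolant.  In a model of A and of the A-projection of
-- the negated clause, let x be the value of a.  With p_x false, the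
-- A-projection of a ≠ b is satisfied, so I₁ holds, and EQ(x, t i) says that t i
-- has the value of a.  The A-projection of a = b is satisfied too, whatever p_x
-- is, so I₂ holds when x has the value of a, and therefore I₂(t i) holds
-- wherever EQ(x, t i) does.  As the holes are positive (fill-monotone), the new
-- interpolant follows from I₁.
--
-- B refutes the new interpolant.  In a model of B and of the B-projection of
-- the negated clause, let x be the value of b.  With p_x true, the B-projection
-- of a ≠ b is satisfied, and EQ(x, t i) says that the value of t i differs from
-- that of b.  The B-projection of a = b is satisfied as well, so I₂ fails when
-- x has the value of b, and therefore I₂(t i) implies EQ(x, t i).  By
-- positivity the new interpolant implies I₁, which is refuted.
--
-- Symbols.  The new interpolant has the symbols of I₁ outside its holes, those
-- of the t i in the holes, and those of I₂ other than x.  None of them is an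
-- auxiliary variable of a = b, so the auxiliary ones belong to C₁ or C₂.

open import Defs
open import Data.Bool using (Bool; true; false) renaming (T to IsTrue)
open import Data.Fin using (Fin)
open import Data.List using (List; []; _∷_; _++_; map; concatMap)
open import Data.List.Membership.Propositional using (_∈_; _∉_)
open import Data.List.Membership.Propositional.Properties using (∈-++⁺ˡ; ∈-++⁺ʳ)
open import Data.List.Properties using (concatMap-++)
open import Data.List.Relation.Unary.All as All using (All; []; _∷_)
open import Data.List.Relation.Unary.All.Properties using (++⁺; ++⁻ˡ; ++⁻ʳ)
open import Data.List.Relation.Unary.Any using (here; there)
open import Data.Nat using (ℕ)
open import Data.Product using (_×_; _,_; proj₁; proj₂)
open import Data.Sum as Sum using (_⊎_; inj₁; inj₂; [_,_]′)
open import Data.Unit using (tt)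
open import Function using (id; _∘_)
open import Relation.Binary.PropositionalEquality
  using (_≡_; _≢_; refl; sym; trans; cong; cong₂; subst)
open import Relation.Nullary using (¬_; yes; no; contradiction)

-- Interpreting symbols anew

FunctionInterpretation RelationInterpretation : ∀ {S} → Structure S → Set
FunctionInterpretation {S} M =
  ∀ {ss s} → Signature.Fun S ss s → All (Carrier Dom) ss → Carrier Dom s
  where open Structure M
RelationInterpretation {S} M =
  ∀ {ss} → Signature.Rel S ss → All (Carrier Dom) ss → Bool
  where open Structure M

reinterpret : ∀ {S} (M : Structure S) →
              FunctionInterpretation M → RelationInterpretation M → Structure S
reinterpret M fun′ rel′ = record
  { Dom   = Dom
  ; point = point
  ; _≟ᵈ_  = _≟ᵈ_
  ; funᴹ  = fun′
  ; relᴹ  = rel′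
  }
  where open Structure M

module Coincidence {S : Signature} (M : Structure S)
         (fun′ : FunctionInterpretation M) (rel′ : RelationInterpretation M) where
  open Structure M

  private
    M′ : Structure S
    M′ = reinterpret M fun′ rel′

  Unchanged : Symbol S → Set
  Unchanged (fun f) = ∀ vs → fun′ f vs ≡ funᴹ f vs
  Unchanged (rel r) = ∀ vs → rel′ r vs ≡ relᴹ r vs

  coincidenceᵗ  : ∀ {s} (t : Term S s) → All Unchanged (symbolsᵗ t) →
                  eval M′ t ≡ eval M t
  coincidenceᵗˢ : ∀ {ss} (ts : Terms S ss) → All Unchanged (symbolsᵗˢ ts) →
                  evals M′ ts ≡ evals M ts
  coincidenceᵗ (app f ts) (u ∷ us) =
    trans (u (evals M′ ts)) (cong (funᴹ f) (coincidenceᵗˢ ts us))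
  coincidenceᵗ (op o ts)  us = cong (evalOp Dom o) (coincidenceᵗˢ ts us)
  coincidenceᵗˢ []       us = refl
  coincidenceᵗˢ (t ∷ ts) us =
    cong₂ _∷_ (coincidenceᵗ t (++⁻ˡ (symbolsᵗ t) us))
              (coincidenceᵗˢ ts (++⁻ʳ (symbolsᵗ t) us))

  private
    coincidence₂ : ∀ {s s′} (t : Term S s) (u : Term S s′) {X : Set₁}
                   (R : Carrier Dom s → Carrier Dom s′ → X) →
                   All Unchanged (symbolsᵗ t ++ symbolsᵗ u) →
                   R (eval M′ t) (eval M′ u) ≡ R (eval M t) (eval M u)
    coincidence₂ t u R us =
      cong₂ R (coincidenceᵗ t (++⁻ˡ (symbolsᵗ t) us))
              (coincidenceᵗ u (++⁻ʳ (symbolsᵗ t) us))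

  coincidenceᵃ : ∀ α → All Unchanged (symbolsᵃ α) → Holds M′ α ≡ Holds M α
  coincidenceᵃ (eq t u)     us = coincidence₂ t u _≡_ us
  coincidenceᵃ (le {n} t u) us = coincidence₂ t u (_≤ᵛ_ {n}) us
  coincidenceᵃ (lt {n} t u) us = coincidence₂ t u (_<ᵛ_ {n}) us
  coincidenceᵃ (pred r ts) (u ∷ us) =
    cong IsTrue (trans (u (evals M′ ts)) (cong (relᴹ r) (coincidenceᵗˢ ts us)))

  -- An equality of types rather than an equivalence, so that every connective,
  -- negation included, is dealt with by congruence.
  coincidenceᶠ : ∀ F → All Unchanged (symb F) → (M′ ⊩ F) ≡ (M ⊩ F)
  coincidenceᶠ (atom α) us = coincidenceᵃ α us
  coincidenceᶠ ⊤ᶠ       us = refl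
  coincidenceᶠ ⊥ᶠ       us = refl
  coincidenceᶠ (¬ᶠ F)   us = cong ¬_ (coincidenceᶠ F us)
  coincidenceᶠ (F ∧ᶠ G) us = cong₂ _×_ (coincidenceᶠ F (++⁻ˡ (symb F) us))
                                       (coincidenceᶠ G (++⁻ʳ (symb F) us))
  coincidenceᶠ (F ∨ᶠ G) us = cong₂ _⊎_ (coincidenceᶠ F (++⁻ˡ (symb F) us))
                                       (coincidenceᶠ G (++⁻ʳ (symb F) us))

-- Assigning a value to a variable, and substitution

-- The case distinction follows substApp, so that the two can be compared by
-- the same analysis.
assign : ∀ {S r} (M : Structure S) → Var S r → Carrier (Structure.Dom M) r →
         FunctionInterpretation M
assign {S} {r} M x v {ss} {s} f vs with _≟ˢˢ_ {S} ss [] | _≟ˢ_ {S} s r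
... | no _     | _        = Structure.funᴹ M f vs
... | yes _    | no _     = Structure.funᴹ M f vs
... | yes refl | yes refl with Signature._≟ᶠ_ S f x
...   | yes _ = v
...   | no _  = Structure.funᴹ M f vs

_[_↦_] : ∀ {S r} (M : Structure S) → Var S r → Carrier (Structure.Dom M) r → Structure S
M [ x ↦ v ] = reinterpret M (assign M x v) (Structure.relᴹ M)

assign-self : ∀ {S r} (M : Structure S) (x : Var S r) v → assign M x v x [] ≡ v
assign-self {S} {r} M x v with _≟ˢ_ {S} r r
... | no r≢r   = contradiction refl r≢r
... | yes refl with Signature._≟ᶠ_ S x x
...   | yes _  = refl
...   | no x≢x = contradiction refl x≢x

assign-other : ∀ {S r} (M : Structure S) (x : Var S r) v {ss s}
               (f : Signature.Fun S ss s) → fun {S} f ≢ fun x →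
               ∀ vs → assign M x v f vs ≡ Structure.funᴹ M f vs
assign-other {S} {r} M x v {ss} {s} f f≢x vs with _≟ˢˢ_ {S} ss [] | _≟ˢ_ {S} s r
... | no _     | _        = refl
... | yes _    | no _     = refl
... | yes refl | yes refl with Signature._≟ᶠ_ S f x
...   | yes refl = contradiction refl f≢x
...   | no _     = refl

module _ {S : Signature} {r : SortOf S} (x : Var S r) (u : Term S r) where

  module Substitution (M : Structure S) where
    open Structure M

    private
      M′ : Structure S
      M′ = M [ x ↦ eval M u ]

    eval-substApp : ∀ {ss s} (f : Signature.Fun S ss s) (ts : Terms S ss) →
                    eval M (substApp x u f ts) ≡ assign M x (eval M u) f (evals M ts)
    eval-substApp {ss} {s} f ts with _≟ˢˢ_ {S} ss [] | _≟ˢ_ {S} s r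
    ... | no _     | _        = refl
    ... | yes _    | no _     = refl
    ... | yes refl | yes refl with Signature._≟ᶠ_ S f x
    ...   | yes _ = refl
    ...   | no _  = refl

    substitutionᵗ  : ∀ {s} (t : Term S s) → eval M (substᵗ x u t) ≡ eval M′ t
    substitutionᵗˢ : ∀ {ss} (ts : Terms S ss) → evals M (substᵗˢ x u ts) ≡ evals M′ ts
    substitutionᵗ (app f ts) =
      trans (eval-substApp f (substᵗˢ x u ts))
            (cong (assign M x (eval M u) f) (substitutionᵗˢ ts))
    substitutionᵗ (op o ts)  = cong (evalOp Dom o) (substitutionᵗˢ ts)
    substitutionᵗˢ []        = refl
    substitutionᵗˢ (t ∷ ts)  = cong₂ _∷_ (substitutionᵗ t) (substitutionᵗˢ ts)

    substitutionᵃ : ∀ α → Holds M (substᵃ x u α) ≡ Holds M′ α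
    substitutionᵃ (eq t v)     = cong₂ _≡_ (substitutionᵗ t) (substitutionᵗ v)
    substitutionᵃ (le {n} t v) = cong₂ (_≤ᵛ_ {n}) (substitutionᵗ t) (substitutionᵗ v)
    substitutionᵃ (lt {n} t v) = cong₂ (_<ᵛ_ {n}) (substitutionᵗ t) (substitutionᵗ v)
    substitutionᵃ (pred p ts)  = cong (IsTrue ∘ relᴹ p) (substitutionᵗˢ ts)

    substitutionᶠ : ∀ F → (M ⊩ F [ x ≔ u ]) ≡ (M′ ⊩ F)
    substitutionᶠ (atom α) = substitutionᵃ α
    substitutionᶠ ⊤ᶠ       = refl
    substitutionᶠ ⊥ᶠ       = refl
    substitutionᶠ (¬ᶠ F)   = cong ¬_ (substitutionᶠ F)
    substitutionᶠ (F ∧ᶠ G) = cong₂ _×_ (substitutionᶠ F) (substitutionᶠ G)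
    substitutionᶠ (F ∨ᶠ G) = cong₂ _⊎_ (substitutionᶠ F) (substitutionᶠ G)

  -- Since P need only hold of the symbols other than x, these lemmas also say
  -- that substitution eliminates x.
  module SubstitutionSymbols {P : Symbol S → Set} (Pu : All P (symbolsᵗ u)) where

    private
      P∖x : Symbol S → Set
      P∖x f = f ≢ fun x → P f

    symbols-substApp : ∀ {ss s} (f : Signature.Fun S ss s) (ts : Terms S ss) →
                       P∖x (fun f) → All P (symbolsᵗˢ ts) →
                       All P (symbolsᵗ (substApp x u f ts))
    symbols-substApp {ss} {s} f ts Pf Pts with _≟ˢˢ_ {S} ss [] | _≟ˢ_ {S} s r
    ... | no ss≢[] | _        = Pf (λ { refl → ss≢[] refl }) ∷ Pts
    ... | yes _    | no s≢r   = Pf (λ { refl → s≢r refl }) ∷ Pts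
    ... | yes refl | yes refl with Signature._≟ᶠ_ S f x
    ...   | yes _  = Pu
    ...   | no f≢x = Pf (λ { refl → f≢x refl }) ∷ Pts

    symbols-substᵗ  : ∀ {s} (t : Term S s) → All P∖x (symbolsᵗ t) →
                      All P (symbolsᵗ (substᵗ x u t))
    symbols-substᵗˢ : ∀ {ss} (ts : Terms S ss) → All P∖x (symbolsᵗˢ ts) →
                      All P (symbolsᵗˢ (substᵗˢ x u ts))
    symbols-substᵗ (app f ts) (Pf ∷ Pts) =
      symbols-substApp f (substᵗˢ x u ts) Pf (symbols-substᵗˢ ts Pts)
    symbols-substᵗ (op o ts)  Pts = symbols-substᵗˢ ts Pts
    symbols-substᵗˢ []       _  = []
    symbols-substᵗˢ (t ∷ ts) Ps =
      ++⁺ (symbols-substᵗ t (++⁻ˡ (symbolsᵗ t) Ps))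
          (symbols-substᵗˢ ts (++⁻ʳ (symbolsᵗ t) Ps))

    private
      symbols-subst₂ : ∀ {s s′} (t : Term S s) (v : Term S s′) →
                       All P∖x (symbolsᵗ t ++ symbolsᵗ v) →
                       All P (symbolsᵗ (substᵗ x u t) ++ symbolsᵗ (substᵗ x u v))
      symbols-subst₂ t v Ps =
        ++⁺ (symbols-substᵗ t (++⁻ˡ (symbolsᵗ t) Ps))
            (symbols-substᵗ v (++⁻ʳ (symbolsᵗ t) Ps))

    symbols-substᵃ : ∀ α → All P∖x (symbolsᵃ α) → All P (symbolsᵃ (substᵃ x u α))
    symbols-substᵃ (eq t v) Ps = symbols-subst₂ t v Ps
    symbols-substᵃ (le t v) Ps = symbols-subst₂ t v Ps
    symbols-substᵃ (lt t v) Ps = symbols-subst₂ t v Ps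
    symbols-substᵃ (pred p ts) (Pp ∷ Ps) = Pp (λ ()) ∷ symbols-substᵗˢ ts Ps

    symbols-substᶠ : ∀ F → All P∖x (symb F) → All P (symb (F [ x ≔ u ]))
    symbols-substᶠ (atom α) Ps = symbols-substᵃ α Ps
    symbols-substᶠ ⊤ᶠ       _  = []
    symbols-substᶠ ⊥ᶠ       _  = []
    symbols-substᶠ (¬ᶠ F)   Ps = symbols-substᶠ F Ps
    symbols-substᶠ (F ∧ᶠ G) Ps = ++⁺ (symbols-substᶠ F (++⁻ˡ (symb F) Ps))
                                     (symbols-substᶠ G (++⁻ʳ (symb F) Ps))
    symbols-substᶠ (F ∨ᶠ G) Ps = ++⁺ (symbols-substᶠ F (++⁻ˡ (symb F) Ps))
                                     (symbols-substᶠ G (++⁻ʳ (symb F) Ps))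

-- Replacing the sub-formulae in the holes of a context

-- This is where the holes being positive is used.  The two structures may
-- differ, as long as they agree on the symbols outside the holes.
fill-monotone : ∀ {S n} {P : Symbol S → Set} {M N : Structure S} →
                (∀ α → All P (symbolsᵃ α) → Holds M α ≡ Holds N α) →
                (I : Context S n) → All P (symbolsᶜ I) →
                {G H : Fin n → Formula S} → (∀ i → M ⊩ G i → N ⊩ H i) →
                M ⊩ fill I G → N ⊩ fill I H
fill-monotone agree (lit true  α) Ps G⇒H h = subst id (agree α Ps) h
fill-monotone agree (lit false α) Ps G⇒H h = h ∘ subst id (sym (agree α Ps))
fill-monotone agree ⊤ᶜ Ps G⇒H h = tt
fill-monotone agree (I ∧ᶜ J) Ps G⇒H (h , k) =
  fill-monotone agree I (++⁻ˡ (symbolsᶜ I) Ps) G⇒H h ,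
  fill-monotone agree J (++⁻ʳ (symbolsᶜ I) Ps) G⇒H k
fill-monotone agree (I ∨ᶜ J) Ps G⇒H =
  Sum.map (fill-monotone agree I (++⁻ˡ (symbolsᶜ I) Ps) G⇒H)
          (fill-monotone agree J (++⁻ʳ (symbolsᶜ I) Ps) G⇒H)
fill-monotone agree (hole i) Ps G⇒H h = G⇒H i h

-- What is known of the symbols of G i may be used for those of H i only if the
-- hole i occurs in the context, hence the hypothesis on the whole of fill I G.
symbols-fill : ∀ {S n} {P Q : Symbol S → Set} (I : Context S n) →
               All (λ f → P f → Q f) (symbolsᶜ I) → {G H : Fin n → Formula S} →
               (∀ i → All P (symb (G i)) → All Q (symb (H i))) →
               All P (symb (fill I G)) → All Q (symb (fill I H))
symbols-fill (lit true  α) P⇒Q G⇒H Ps = All.zipWith (λ (p⇒q , p) → p⇒q p) (P⇒Q , Ps)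
symbols-fill (lit false α) P⇒Q G⇒H Ps = All.zipWith (λ (p⇒q , p) → p⇒q p) (P⇒Q , Ps)
symbols-fill ⊤ᶜ P⇒Q G⇒H Ps = []
symbols-fill ⊥ᶜ P⇒Q G⇒H Ps = []
symbols-fill (I ∧ᶜ J) P⇒Q {G} G⇒H Ps =
  ++⁺ (symbols-fill I (++⁻ˡ (symbolsᶜ I) P⇒Q) G⇒H (++⁻ˡ (symb (fill I G)) Ps))
      (symbols-fill J (++⁻ʳ (symbolsᶜ I) P⇒Q) G⇒H (++⁻ʳ (symb (fill I G)) Ps))
symbols-fill (I ∨ᶜ J) P⇒Q {G} G⇒H Ps =
  ++⁺ (symbols-fill I (++⁻ˡ (symbolsᶜ I) P⇒Q) G⇒H (++⁻ˡ (symb (fill I G)) Ps))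
      (symbols-fill J (++⁻ʳ (symbolsᶜ I) P⇒Q) G⇒H (++⁻ʳ (symb (fill I G)) Ps))
symbols-fill (hole i) P⇒Q G⇒H Ps = G⇒H i Ps

-- Symbols of lifted formulae and of projections

data Original {S : Signature} : Symbol (S ⁺) → Set where
  fun : ∀ {ss s} {f : Signature.Fun S ss s} → Original (fun (base f))
  rel : ∀ {ss} {r : Signature.Rel S ss} → Original (rel (base r))

original-liftᵗ  : ∀ {S s} (t : Term S s) → All Original (symbolsᵗ (liftᵗ t))
original-liftᵗˢ : ∀ {S ss} (ts : Terms S ss) → All Original (symbolsᵗˢ (liftᵗˢ ts))
original-liftᵗ (app f ts) = fun ∷ original-liftᵗˢ ts
original-liftᵗ (op o ts)  = original-liftᵗˢ ts
original-liftᵗˢ []        = []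
original-liftᵗˢ (t ∷ ts)  = ++⁺ (original-liftᵗ t) (original-liftᵗˢ ts)

original-liftᵃ : ∀ {S} (α : Atom S) → All Original (symbolsᵃ (liftᵃ α))
original-liftᵃ (eq t u)    = ++⁺ (original-liftᵗ t) (original-liftᵗ u)
original-liftᵃ (le t u)    = ++⁺ (original-liftᵗ t) (original-liftᵗ u)
original-liftᵃ (lt t u)    = ++⁺ (original-liftᵗ t) (original-liftᵗ u)
original-liftᵃ (pred r ts) = rel ∷ original-liftᵗˢ ts

original-lift : ∀ {S} (F : Formula S) → All Original (symb (lift F))
original-lift (atom α) = original-liftᵃ α
original-lift ⊤ᶠ       = []
original-lift ⊥ᶠ       = []
original-lift (¬ᶠ F)   = original-lift F
original-lift (F ∧ᶠ G) = ++⁺ (original-lift F) (original-lift G)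
original-lift (F ∨ᶠ G) = ++⁺ (original-lift F) (original-lift G)

OriginalOr : ∀ {S} → List (Symbol (S ⁺)) → Symbol (S ⁺) → Set
OriginalOr fs f = Original f ⊎ f ∈ fs

private
  originals : ∀ {S fs} {gs : List (Symbol (S ⁺))} →
              All Original gs → All (OriginalOr fs) gs
  originals = All.map inj₁

symbols-signed : ∀ {S fs} σ (α : Atom S) → All (OriginalOr fs) (symb (signed σ α))
symbols-signed true  α = originals (original-liftᵃ α)
symbols-signed false α = originals (original-liftᵃ α)

symbols-sharedProjA : ∀ {S fs} π σ (α : Atom S) →
                      All (OriginalOr fs) (symb (sharedProjA π σ α))
symbols-sharedProjA pudlák   σ α = symbols-signed σ α
symbols-sharedProjA mcMillan σ α = []

symbols-⊴ : ∀ {S n} {P : Symbol S → Set} (t : Term S (num n)) (c : Bound n) →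
            All P (symbolsᵗ t) → All P (symb (t ⊴ c))
symbols-⊴ t (atMost c) Ps = ++⁺ Ps []
symbols-⊴ t (below c)  Ps = ++⁺ Ps []

symbols-minus : ∀ {S n} {P : Symbol S → Set} (t : Term S (num n)) →
                All P (symbolsᵗ t) → All P (symbolsᵗ (minus t))
symbols-minus {n = int} t Ps = ++⁺ Ps []
symbols-minus {n = rat} t Ps = ++⁺ Ps []

module _ {S : Signature} {A B : Formula S} (π : SharedProjection) where

  symbols-projA : (ℓ : Literal A B) → All (OriginalOr (auxiliary ℓ)) (symb (projA π ℓ))
  symbols-projA (aLocal σ α _) = symbols-signed σ α
  symbols-projA (bLocal σ α _) = []
  symbols-projA (shared σ α _) = symbols-sharedProjA π σ α
  symbols-projA (mixedEq true a b _ _) =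
    ++⁺ (originals (original-liftᵗ a)) (inj₂ (here refl) ∷ [])
  symbols-projA (mixedEq false a b _ _) = ++⁺ (p ∷ a≐x) (p ∷ a≐x)
    where
    p   = inj₂ (here refl)
    a≐x = ++⁺ (originals (original-liftᵗ a)) (inj₂ (there (here refl)) ∷ [])
  symbols-projA (mixedLe {n} a b c _ _ _) =
    symbols-⊴ (plus (liftᵗ (linTerm a)) (var (leVar a b c))) (atMost (zeroᵛ n))
      (++⁺ (originals (original-liftᵗ (linTerm a))) (inj₂ (here refl) ∷ []))

  symbols-projB : (ℓ : Literal A B) → All (OriginalOr (auxiliary ℓ)) (symb (projB π ℓ))
  symbols-projB (aLocal σ α _) = []
  symbols-projB (bLocal σ α _) = symbols-signed σ α
  symbols-projB (shared σ α _) = symbols-signed σ α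
  symbols-projB (mixedEq true a b _ _) =
    inj₂ (here refl) ∷ originals (original-liftᵗ b)
  symbols-projB (mixedEq false a b _ _) = ++⁺ (p ∷ x≐b) (p ∷ x≐b)
    where
    p   = inj₂ (here refl)
    x≐b = inj₂ (there (here refl)) ∷ originals (original-liftᵗ b)
  symbols-projB (mixedLe a b c _ _ _) =
    symbols-⊴ (plus (minus (var (leVar a b c))) (liftᵗ (linTerm b))) c
      (++⁺ (symbols-minus (var (leVar a b c)) (inj₂ (here refl) ∷ []))
           (++⁺ (originals (original-liftᵗ (linTerm b))) []))

symbols-⋀ : ∀ {S} {X : Set} {P : Symbol S → Set} (g : X → Formula S) {xs : List X} →
            All (λ y → All P (symb (g y))) xs → All P (symb (⋀ (map g xs)))
symbols-⋀ g []       = []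
symbols-⋀ g (p ∷ ps) = ++⁺ p (symbols-⋀ g ps)

⋀-++⁻ : ∀ {S} (M : Structure S) {X : Set} (g : X → Formula S) (xs ys : List X) →
        M ⊩ ⋀ (map g (xs ++ ys)) → M ⊩ ⋀ (map g xs) × M ⊩ ⋀ (map g ys)
⋀-++⁻ M g []       ys h       = tt , h
⋀-++⁻ M g (x ∷ xs) ys (h , k) =
  let (k₁ , k₂) = ⋀-++⁻ M g xs ys k in (h , k₁) , k₂

-- The auxiliary variables of one mixed equality

module _ {S : Signature} {s : SortOf S} (a b : Term S s) where

  Fresh : Symbol (S ⁺) → Set
  Fresh f = f ≢ fun (eqVar a b) × f ≢ rel (boolVar a b)

  original⇒fresh : ∀ {f} → Original f → Fresh f
  original⇒fresh fun = (λ ()) , (λ ())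
  original⇒fresh rel = (λ ()) , (λ ())

  fresh-lift : (F : Formula S) → All Fresh (symb (lift F))
  fresh-lift F = All.map original⇒fresh (original-lift F)

  ∉⇒fresh : ∀ {fs} → fun (eqVar a b) ∉ fs → rel (boolVar a b) ∉ fs → All Fresh fs
  ∉⇒fresh x∉ p∉ = All.tabulate (λ f∈ → (λ { refl → x∉ f∈ }) , (λ { refl → p∉ f∈ }))

  module _ {A B : Formula S}
           (la : ALocal A B (symbolsᵗ a)) (lb : BLocal A B (symbolsᵗ b)) where

    Avoids : Literal A B → Set
    Avoids ℓ = ∀ σ → mixedEq σ a b la lb ≢ ℓ

    ∉⇒avoids : ∀ {C} → mixedEq true a b la lb ∉ C → mixedEq false a b la lb ∉ C →
               All Avoids C
    ∉⇒avoids t∉ f∉ = All.tabulate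
      (λ ℓ∈ → λ { true refl → t∉ ℓ∈ ; false refl → f∉ ℓ∈ })

    -- Negation only changes the sign of a mixed equality, and equal auxiliary
    -- variables belong to equal atoms.
    fresh-auxiliary : ∀ ℓ → Avoids ℓ → All Fresh (auxiliary (negate ℓ))
    fresh-auxiliary (aLocal _ _ _) _ = []
    fresh-auxiliary (bLocal _ _ _) _ = []
    fresh-auxiliary (shared _ _ _) _ = []
    fresh-auxiliary (mixedEq true  _ _ _ _) av =
      ((λ ()) , (λ { refl → av true refl })) ∷ ((λ { refl → av true refl }) , (λ ())) ∷ []
    fresh-auxiliary (mixedEq false _ _ _ _) av =
      ((λ { refl → av false refl }) , (λ ())) ∷ []
    fresh-auxiliary (mixedLe _ _ _ _ _ _) _ = ((λ ()) , (λ ())) ∷ []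

    private
      fresh : ∀ ℓ → Avoids ℓ → ∀ {f} → OriginalOr (auxiliary (negate ℓ)) f → Fresh f
      fresh ℓ av = [ original⇒fresh , All.lookup (fresh-auxiliary ℓ av) ]′

    fresh-negProjA : ∀ π {C} → All Avoids C → All Fresh (symb (negProjA π C))
    fresh-negProjA π avs = symbols-⋀ _
      (All.map (λ {ℓ} av → All.map (fresh ℓ av) (symbols-projA π (negate ℓ))) avs)

    fresh-negProjB : ∀ π {C} → All Avoids C → All Fresh (symb (negProjB π C))
    fresh-negProjB π avs = symbols-⋀ _
      (All.map (λ {ℓ} av → All.map (fresh ℓ av) (symbols-projB π (negate ℓ))) avs)

  module Valuation (M : Structure (S ⁺)) where
    open Structure M

    private
      x = eqVar a b
      p = boolVar a b

    -- Relation symbols in general cannot be compared, but the auxiliary ones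
    -- can, through the terms of the equalities that they belong to.
    assignBool : Bool → RelationInterpretation M
    assignBool β (base r) vs = relᴹ (base r) vs
    assignBool β (boolVar {s′} a′ b′) vs with _≟ˢ_ {S} s′ s
    ... | no _     = relᴹ (boolVar a′ b′) vs
    ... | yes refl with a′ ≟ᵗ a | b′ ≟ᵗ b
    ...   | yes _ | yes _ = β
    ...   | yes _ | no _  = relᴹ (boolVar a′ b′) vs
    ...   | no _  | _     = relᴹ (boolVar a′ b′) vs

    assignBool-self : ∀ β → assignBool β p [] ≡ β
    assignBool-self β with _≟ˢ_ {S} s s
    ... | no s≢s   = contradiction refl s≢s
    ... | yes refl with a ≟ᵗ a | b ≟ᵗ b
    ...   | yes _  | yes _  = refl
    ...   | yes _  | no b≢b = contradiction refl b≢b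
    ...   | no a≢a | _      = contradiction refl a≢a

    assignBool-other : ∀ β {ss} (r : Rel⁺ S ss) → rel {S ⁺} r ≢ rel p →
                       ∀ vs → assignBool β r vs ≡ relᴹ r vs
    assignBool-other β (base r) r≢p vs = refl
    assignBool-other β (boolVar {s′} a′ b′) r≢p vs with _≟ˢ_ {S} s′ s
    ... | no _     = refl
    ... | yes refl with a′ ≟ᵗ a | b′ ≟ᵗ b
    ...   | yes refl | yes refl = contradiction refl r≢p
    ...   | yes _    | no _     = refl
    ...   | no _     | _        = refl

    ⟨_,_⟩ : Carrier Dom s → Bool → Structure (S ⁺)
    ⟨ v , β ⟩ = reinterpret M (assign M x v) (assignBool β)

    ⊩p : ∀ v → ⟨ v , true ⟩ ⊩ atom (pred p [])
    ⊩p v = subst IsTrue (sym (assignBool-self true)) tt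

    ⊮p : ∀ v → ¬ (⟨ v , false ⟩ ⊩ atom (pred p []))
    ⊮p v = subst IsTrue (assignBool-self false)

    -- Covers both M [ x ↦ v ], to which substitution for x in I₂ amounts, and
    -- ⟨ v , β ⟩, which also gives p_x the value by which the projection of
    -- a ≠ b is satisfied.
    module Reset (v : Carrier Dom s) {rel′ : RelationInterpretation M}
             (other : ∀ {ss} (r : Rel⁺ S ss) → rel {S ⁺} r ≢ rel p →
                      ∀ vs → rel′ r vs ≡ relᴹ r vs) where
      open Coincidence M (assign M x v) rel′

      private
        N : Structure (S ⁺)
        N = reinterpret M (assign M x v) rel′

        unchanged : ∀ {f} → Fresh f → Unchanged f
        unchanged {fun f} (f≢x , _) = assign-other M x v f f≢x
        unchanged {rel r} (_ , r≢p) = other r r≢p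

      fresh-atom : ∀ α → All Fresh (symbolsᵃ α) → Holds N α ≡ Holds M α
      fresh-atom α fr = coincidenceᵃ α (All.map unchanged fr)

      keep : ∀ F → All Fresh (symb F) → M ⊩ F → N ⊩ F
      keep F fr = subst id (sym (coincidenceᶠ F (All.map unchanged fr)))

      ⊩x≐⁺ : ∀ u → All Fresh (symbolsᵗ u) → eval M u ≡ v → N ⊩ var x ≐ u
      ⊩x≐⁺ u fr u≡v =
        trans (assign-self M x v)
              (sym (trans (coincidenceᵗ u (All.map unchanged fr)) u≡v))

      ⊩x≐⁻ : ∀ u → All Fresh (symbolsᵗ u) → N ⊩ var x ≐ u → eval M u ≡ v
      ⊩x≐⁻ u fr x≡u =
        trans (sym (coincidenceᵗ u (All.map unchanged fr)))
              (trans (sym x≡u) (assign-self M x v))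

-- Resolution on the mixed equality

module _ {S : Signature} (π : SharedProjection) {A B : Formula S}
         {s : SortOf S} (a b : Term S s)
         (la : ALocal A B (symbolsᵗ a)) (lb : BLocal A B (symbolsᵗ b))
         {C₁ C₂ : Clause A B}
         (C₁-avoids : All (Avoids a b la lb) C₁) (C₂-avoids : All (Avoids a b la lb) C₂)
         {n : ℕ} (I₁ : Context (S ⁺) n) (t : Fin n → Term (S ⁺) s)
         (I₁-fresh : All (Fresh a b) (symbolsᶜ I₁))
         (t-fresh : ∀ i → All (Fresh a b) (symbolsᵗ (t i)))
         (P₁ : PartialInterpolant π A B (mixedEq true a b la lb ∷ C₁)
                 (fill I₁ (λ i → EQ a b (t i))))
         {I₂ : Formula (S ⁺)}
         (P₂ : PartialInterpolant π A B (mixedEq false a b la lb ∷ C₂) I₂) where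

  private
    module P₁ = PartialInterpolant P₁
    module P₂ = PartialInterpolant P₂

    x = eqVar a b

    I : Formula (S ⁺)
    I = fill I₁ (λ i → I₂ [ x ≔ t i ])

    fresh-a : All (Fresh a b) (symbolsᵗ (liftᵗ a))
    fresh-a = All.map (original⇒fresh a b) (original-liftᵗ a)

    fresh-b : All (Fresh a b) (symbolsᵗ (liftᵗ b))
    fresh-b = All.map (original⇒fresh a b) (original-liftᵗ b)

  resolvent-fromA : lift A ∧ᶠ negProjA π (C₁ ++ C₂) ⊨ I
  resolvent-fromA M (⊩A , ⊩C) =
    fill-monotone Xp.fresh-atom I₁ I₁-fresh EQ⇒I₂ (P₁.fromA ⟨ v , false ⟩
      ( Xp.keep (lift A) (fresh-lift a b A) ⊩A
      , ⊩a≠b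
      , Xp.keep (negProjA π C₁) (fresh-negProjA a b la lb π C₁-avoids) (proj₁ ⊩C₁C₂)))
    where
    open Valuation a b M

    v = eval M (liftᵗ a)

    module X  = Reset v {Structure.relᴹ M} (λ _ _ _ → refl)
    module Xp = Reset v (assignBool-other false)

    ⊩C₁C₂ = ⋀-++⁻ M (projA π ∘ negate) C₁ C₂ ⊩C

    ⊩a≠b : ⟨ v , false ⟩ ⊩ projA π (negate (mixedEq {A = A} {B} true a b la lb))
    ⊩a≠b = inj₂ (⊮p v , sym (Xp.⊩x≐⁺ (liftᵗ a) fresh-a refl))

    I₂-at-a : M [ x ↦ v ] ⊩ I₂
    I₂-at-a = P₂.fromA (M [ x ↦ v ])
      ( X.keep (lift A) (fresh-lift a b A) ⊩A
      , sym (X.⊩x≐⁺ (liftᵗ a) fresh-a refl)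
      , X.keep (negProjA π C₂) (fresh-negProjA a b la lb π C₂-avoids) (proj₂ ⊩C₁C₂))

    EQ⇒I₂ : ∀ i → ⟨ v , false ⟩ ⊩ EQ a b (t i) → M ⊩ I₂ [ x ≔ t i ]
    EQ⇒I₂ i (inj₁ (h , _))   = contradiction h (⊮p v)
    EQ⇒I₂ i (inj₂ (_ , x≡t)) =
      subst id (sym (Substitution.substitutionᶠ x (t i) M I₂))
        (subst (λ w → M [ x ↦ w ] ⊩ I₂)
               (sym (Xp.⊩x≐⁻ (t i) (t-fresh i) x≡t)) I₂-at-a)

  resolvent-refutes : lift B ∧ᶠ negProjB π (C₁ ++ C₂) ∧ᶠ I ⊨ ⊥ᶠ
  resolvent-refutes M (⊩B , ⊩C , ⊩I) = P₁.refutes ⟨ v , true ⟩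
    ( Xp.keep (lift B) (fresh-lift a b B) ⊩B
    , ( ⊩a≠b
      , Xp.keep (negProjB π C₁) (fresh-negProjB a b la lb π C₁-avoids) (proj₁ ⊩C₁C₂))
    , fill-monotone (λ α fr → sym (Xp.fresh-atom α fr)) I₁ I₁-fresh I₂⇒EQ ⊩I)
    where
    open Valuation a b M

    v = eval M (liftᵗ b)

    module X  = Reset v {Structure.relᴹ M} (λ _ _ _ → refl)
    module Xp = Reset v (assignBool-other true)

    ⊩C₁C₂ = ⋀-++⁻ M (projB π ∘ negate) C₁ C₂ ⊩C

    ⊩a≠b : ⟨ v , true ⟩ ⊩ projB π (negate (mixedEq {A = A} {B} true a b la lb))
    ⊩a≠b = inj₂ (contradiction (⊩p v) , Xp.⊩x≐⁺ (liftᵗ b) fresh-b refl)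

    I₂-not-at-b : ¬ (M [ x ↦ v ] ⊩ I₂)
    I₂-not-at-b ⊩I₂ = P₂.refutes (M [ x ↦ v ])
      ( X.keep (lift B) (fresh-lift a b B) ⊩B
      , ( X.⊩x≐⁺ (liftᵗ b) fresh-b refl
        , X.keep (negProjB π C₂) (fresh-negProjB a b la lb π C₂-avoids) (proj₂ ⊩C₁C₂))
      , ⊩I₂)

    I₂⇒EQ : ∀ i → M ⊩ I₂ [ x ≔ t i ] → ⟨ v , true ⟩ ⊩ EQ a b (t i)
    I₂⇒EQ i ⊩I₂ = inj₁ (⊩p v , λ x≡t → I₂-not-at-b
      (subst (λ w → M [ x ↦ w ] ⊩ I₂) (Xp.⊩x≐⁻ (t i) (t-fresh i) x≡t)
        (subst id (Substitution.substitutionᶠ x (t i) M I₂) ⊩I₂)))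

  private
    Permitted : Clause A B → Symbol (S ⁺) → Set
    Permitted C f = (f ∈ symb (lift A) × f ∈ symb (lift B))
                    ⊎ f ∈ concatMap (λ ℓ → auxiliary (negate ℓ)) C

    permitted₁ : ∀ {f} → Fresh a b f →
                 Permitted (mixedEq true a b la lb ∷ C₁) f → Permitted (C₁ ++ C₂) f
    permitted₁ fr (inj₁ sh)                  = inj₁ sh
    permitted₁ fr (inj₂ (here f≡p))          = contradiction f≡p (proj₂ fr)
    permitted₁ fr (inj₂ (there (here f≡x)))  = contradiction f≡x (proj₁ fr)
    permitted₁ fr (inj₂ (there (there f∈)))  =
      inj₂ (subst (_ ∈_) (sym (concatMap-++ _ C₁ C₂)) (∈-++⁺ˡ f∈))

    permitted₂ : ∀ {f} → f ≢ fun x →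
                 Permitted (mixedEq false a b la lb ∷ C₂) f → Permitted (C₁ ++ C₂) f
    permitted₂ f≢x (inj₁ sh)           = inj₁ sh
    permitted₂ f≢x (inj₂ (here f≡x))   = contradiction f≡x f≢x
    permitted₂ f≢x (inj₂ (there f∈))   =
      inj₂ (subst (_ ∈_) (sym (concatMap-++ _ C₁ C₂)) (∈-++⁺ʳ _ f∈))

  resolvent-symbols : All (Permitted (C₁ ++ C₂)) (symb I)
  resolvent-symbols =
    symbols-fill I₁ (All.map permitted₁ I₁-fresh) EQ⇒I₂ (All.tabulate P₁.symbols)
    where
    EQ⇒I₂ : ∀ i → All (Permitted (mixedEq true a b la lb ∷ C₁)) (symb (EQ a b (t i))) →
            All (Permitted (C₁ ++ C₂)) (symb (I₂ [ x ≔ t i ]))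
    -- The symbols of EQ a b (t i) are p_x, x and those of t i, twice over.
    EQ⇒I₂ i (_ ∷ _ ∷ Ps) = symbols-substᶠ I₂
      (All.tabulate (λ f∈ f≢x → permitted₂ f≢x (P₂.symbols f∈)))
      where
      open SubstitutionSymbols x (t i)
        (All.zipWith (λ (fr , p) → permitted₁ fr p)
          (t-fresh i , ++⁻ˡ (symbolsᵗ (t i)) Ps))

  resolvent-interpolant : PartialInterpolant π A B (C₁ ++ C₂) I
  resolvent-interpolant = record
    { fromA   = resolvent-fromA
    ; refutes = resolvent-refutes
    ; symbols = All.lookup resolvent-symbols
    }

theorem2 : (S : Signature) (π : SharedProjection) (A B : Formula S) →
    InterpolationProblem A B →
    {s : SortOf S} (a b : Term S s) →
    (la : ALocal A B (symbolsᵗ a)) (lb : BLocal A B (symbolsᵗ b)) →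
    (C₁ C₂ : Clause A B) →
    mixedEq true a b la lb ∉ C₁ → mixedEq false a b la lb ∉ C₁ →
    mixedEq true a b la lb ∉ C₂ → mixedEq false a b la lb ∉ C₂ →
    (n : ℕ) (I₁ : Context (S ⁺) n) (t : Fin n → Term (S ⁺) s) →
    fun (eqVar a b) ∉ symbolsᶜ I₁ → rel (boolVar a b) ∉ symbolsᶜ I₁ →
    (∀ i → fun (eqVar a b) ∉ symbolsᵗ (t i)) →
    (∀ i → rel (boolVar a b) ∉ symbolsᵗ (t i)) →
    PartialInterpolant π A B (mixedEq true a b la lb ∷ C₁) (fill I₁ (λ i → EQ a b (t i))) →
    (I₂ : Formula (S ⁺)) →
    PartialInterpolant π A B (mixedEq false a b la lb ∷ C₂) I₂ →
    PartialInterpolant π A B (C₁ ++ C₂) (fill I₁ (λ i → I₂ [ eqVar a b ≔ t i ]))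
theorem2 S π A B _ a b la lb C₁ C₂ t∉C₁ f∉C₁ t∉C₂ f∉C₂ n I₁ t x∉I₁ p∉I₁ x∉t p∉t P₁ I₂ P₂ =
  resolvent-interpolant π a b la lb
    (∉⇒avoids a b la lb t∉C₁ f∉C₁) (∉⇒avoids a b la lb t∉C₂ f∉C₂)
    I₁ t (∉⇒fresh a b x∉I₁ p∉I₁) (λ i → ∉⇒fresh a b (x∉t i) (p∉t i)) P₁ P₂
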